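{- The functors $\beta$ and $\iota\,\widehat\beta\,\omega$, from the category of topological spaces to the category of compact Hausdorff topological spaces, are naturally isomorphic.
   Context: On $[0,1]$ put $x\oplus y=\min(x+y,1)$, $x\odot y=\max(x+y-1,0)$, $x\wedge y=\min(x,y)$; these operations and arbitrary joins are extended pointwise to $[0,1]^X$. $\mathbf 0,\mathbf 1$ denote the constant functions $0,1$. An MV-topological space is a pair $\langle X,\tau\rangle$ with $\tau\subseteq[0,1]^X$, $\mathbf 0,\mathbf 1\in\tau$, $\tau$ closed under arbitrary joins and under the binary operations $\odot,\oplus,\wedge$. A map $f:\langle X,\tau_X\rangle\to\langle Y,\tau_Y\rangle$ is continuous if $\alpha\circ f\in\tau_X$ for every $\alpha\in\tau_Y$. ${}^{\mathrm{MV}}\mathrm{Top}$ is the category of MV-topological spaces and continuous maps. $\langle X,\tau\rangle$ is compact if for every $\Gamma\subseteq\tau$ with $\bigvee\Gamma=\mathbf 1$ there is a finite family $(\alpha_k)_{k=1}^n$ of elements of $\Gamma$ (repetitions allowed) with $\alpha_1\oplus\cdots\oplus\alpha_n=\mathbf 1$. It is Hausdorff if for all $x\neq y$ there are $o_x,o_y\in\tau$ with $o_x(x)=o_y(y)=1$ and $o_x\wedge o_y=\mathbf 0$. ${}^{\mathrm{HCMV}}\mathrm{Top}$ is the full subcategory of compact Hausdorff MV-spaces, and $\widehat\beta:{}^{\mathrm{MV}}\mathrm{Top}\to{}^{\mathrm{HCMV}}\mathrm{Top}$ is the left adjoint of the inclusion functor (it exists). $\beta$ is the Stone–Čech compactification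 functor, i.e. the left adjoint of the inclusion of compact Hausdorff topological spaces into the category $\mathrm{Top}$ of topological spaces. $\omega:\mathrm{Top}\to{}^{\mathrm{MV}}\mathrm{Top}$ sends $\langle X,\tau\rangle$ to $\langle X,\omega(\tau)\rangle$, where $\omega(\tau)$ is the set of all lower semicontinuous functions $\langle X,\tau\rangle\to[0,1]$, and is the identity on underlying maps. $\iota$ sends an MV-space $\langle X,\tau\rangle$ to the topological space $\langle X,\iota(\tau)\rangle$, where $\iota(\tau)$ is the topology generated by the subbase $\{\{x\in X:\mu(x)>r\}:\mu\in\tau,\ r\in[0,1)\}$, and is the identity on underlying maps; it sends compact Hausdorff MV-spaces to compact Hausdorff topological spaces. -}

module Defs where

open import Data.Bool.Base using (Bool; true; false)
open import Data.Empty using (⊥-elim)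
open import Data.Integer.Base as ℤ using (+_)
import Data.Integer.Properties as ℤₚ
open import Data.List.Base as List using (List; []; _∷_; foldr)
open import Data.List.Relation.Unary.Any using (Any; here; there)
open import Data.Nat.Base as ℕ using (ℕ; zero; suc)
import Data.Nat.Coprimality as Coprimality
import Data.Nat.Properties as ℕₚ
open import Data.Product using (Σ; ∃; ∃₂; Σ-syntax; _×_; _,_; proj₁; proj₂)
open import Data.Rational.Base as ℚ using (ℚ; 0ℚ; 1ℚ; ½; mkℚ)
import Data.Rational.Properties as ℚₚ
open import Data.Rational.Solver using (module +-*-Solver)
import Data.Rational.Unnormalised.Base as ℚᵘ
import Data.Rational.Unnormalised.Properties as ℚᵘₚ
open import Data.Sum.Base using (_⊎_; inj₁; inj₂)
open import Data.Unit.Polymorphic.Base using (⊤; tt)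
open import Function.Bundles using (Func)
import Function.Construct.Composition as Comp
import Function.Construct.Identity as Ident
open import Level using (Level; Lift; lift; lower) renaming (suc to lsuc; _⊔_ to _⊔ℓ_)
open import Relation.Binary.Bundles using (Setoid)
open import Relation.Binary.Core using (Rel)
open import Relation.Binary.Definitions using (_Respects_)
open import Relation.Binary.PropositionalEquality.Core using (_≡_; refl; sym; trans) renaming (cong to ≡-cong)
open import Relation.Binary.Structures using (IsEquivalence)
open import Relation.Nullary.Decidable.Core using (Dec; yes; no)
open import Relation.Nullary.Negation.Core using (¬_)
open import Relation.Unary using (Pred; _∩_; ⋃; _≐_)

private
  variable
    ℓ o a e o′ a′ e′ o″ a″ e″ p : Level

------------------------------------------------------------------------
-- Categories (hom-setoids, as there is no quotienting)

record Category o a e : Set (lsuc (o ⊔ℓ a ⊔ℓ e)) where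
  infix  4 _≈_ _⇒_
  infixr 9 _∘_
  field
    Obj       : Set o
    _⇒_       : Rel Obj a
    _≈_       : ∀ {A B} → Rel (A ⇒ B) e
    id        : ∀ {A} → A ⇒ A
    _∘_       : ∀ {A B C} → B ⇒ C → A ⇒ B → A ⇒ C
    assoc     : ∀ {A B C D} {f : A ⇒ B} {g : B ⇒ C} {h : C ⇒ D} →
                (h ∘ g) ∘ f ≈ h ∘ (g ∘ f)
    identityˡ : ∀ {A B} {f : A ⇒ B} → id ∘ f ≈ f
    identityʳ : ∀ {A B} {f : A ⇒ B} → f ∘ id ≈ f
    equiv     : ∀ {A B} → IsEquivalence (_≈_ {A} {B})
    ∘-resp-≈  : ∀ {A B C} {f h : B ⇒ C} {g i : A ⇒ B} →
                f ≈ h → g ≈ i → f ∘ g ≈ h ∘ i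

record Functor (C : Category o a e) (D : Category o′ a′ e′) :
               Set (o ⊔ℓ a ⊔ℓ e ⊔ℓ o′ ⊔ℓ a′ ⊔ℓ e′) where
  private
    module C = Category C
    module D = Category D
  field
    F₀           : C.Obj → D.Obj
    F₁           : ∀ {A B} → A C.⇒ B → F₀ A D.⇒ F₀ B
    identity     : ∀ {A} → F₁ (C.id {A}) D.≈ D.id
    homomorphism : ∀ {A B E} {f : A C.⇒ B} {g : B C.⇒ E} →
                   F₁ (g C.∘ f) D.≈ F₁ g D.∘ F₁ f
    F-resp-≈     : ∀ {A B} {f g : A C.⇒ B} → f C.≈ g → F₁ f D.≈ F₁ g

idF : {C : Category o a e} → Functor C C
idF {C = C} = record
  { F₀           = λ A → A
  ; F₁           = λ f → f
  ; identity     = IsEquivalence.refl equiv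
  ; homomorphism = IsEquivalence.refl equiv
  ; F-resp-≈     = λ f≈g → f≈g
  } where open Category C

infixr 9 _∘F_
_∘F_ : {C : Category o a e} {D : Category o′ a′ e′} {E : Category o″ a″ e″} →
       Functor D E → Functor C D → Functor C E
_∘F_ {E = E} G F = record
  { F₀           = λ A → G.F₀ (F.F₀ A)
  ; F₁           = λ f → G.F₁ (F.F₁ f)
  ; identity     = IsEquivalence.trans equiv (G.F-resp-≈ F.identity) G.identity
  ; homomorphism = IsEquivalence.trans equiv (G.F-resp-≈ F.homomorphism) G.homomorphism
  ; F-resp-≈     = λ f≈g → G.F-resp-≈ (F.F-resp-≈ f≈g)
  } where
    open Category E
    module F = Functor F
    module G = Functor G

record NaturalTransformation {C : Category o a e} {D : Category o′ a′ e′}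
         (F G : Functor C D) : Set (o ⊔ℓ a ⊔ℓ e ⊔ℓ o′ ⊔ℓ a′ ⊔ℓ e′) where
  private
    module C = Category C
    module D = Category D
    module F = Functor F
    module G = Functor G
  field
    η       : ∀ A → F.F₀ A D.⇒ G.F₀ A
    commute : ∀ {A B} (f : A C.⇒ B) → η B D.∘ F.F₁ f D.≈ G.F₁ f D.∘ η A

record NaturalIsomorphism {C : Category o a e} {D : Category o′ a′ e′}
         (F G : Functor C D) : Set (o ⊔ℓ a ⊔ℓ e ⊔ℓ o′ ⊔ℓ a′ ⊔ℓ e′) where
  private
    module D = Category D
  field
    F⇒G : NaturalTransformation F G
    F⇐G : NaturalTransformation G F
  private
    module ⇒ = NaturalTransformation F⇒G
    module ⇐ = NaturalTransformation F⇐G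
  field
    isoˡ : ∀ A → ⇐.η A D.∘ ⇒.η A D.≈ D.id
    isoʳ : ∀ A → ⇒.η A D.∘ ⇐.η A D.≈ D.id

infix 5 _⊣_
record _⊣_ {C : Category o a e} {D : Category o′ a′ e′}
         (L : Functor C D) (R : Functor D C) : Set (o ⊔ℓ a ⊔ℓ e ⊔ℓ o′ ⊔ℓ a′ ⊔ℓ e′) where
  private
    module C = Category C
    module D = Category D
    module L = Functor L
    module R = Functor R
  field
    unit   : NaturalTransformation idF (R ∘F L)
    counit : NaturalTransformation (L ∘F R) idF
  private
    module unit   = NaturalTransformation unit
    module counit = NaturalTransformation counit
  field
    zig : ∀ {A} → counit.η (L.F₀ A) D.∘ L.F₁ (unit.η A) D.≈ D.id
    zag : ∀ {B} → R.F₁ (counit.η B) C.∘ unit.η (R.F₀ B) C.≈ C.id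

FullSubcategory : (C : Category o a e) → Pred (Category.Obj C) p → Category (o ⊔ℓ p) a e
FullSubcategory C P = record
  { Obj       = Σ Obj P
  ; _⇒_       = λ A B → proj₁ A ⇒ proj₁ B
  ; _≈_       = _≈_
  ; id        = id
  ; _∘_       = _∘_
  ; assoc     = assoc
  ; identityˡ = identityˡ
  ; identityʳ = identityʳ
  ; equiv     = equiv
  ; ∘-resp-≈  = ∘-resp-≈
  } where open Category C

Inclusion : (C : Category o a e) (P : Pred (Category.Obj C) p) →
            Functor (FullSubcategory C P) C
Inclusion C P = record
  { F₀           = proj₁
  ; F₁           = λ f → f
  ; identity     = IsEquivalence.refl equiv
  ; homomorphism = IsEquivalence.refl equiv
  ; F-resp-≈     = λ f≈g → f≈g
  } where open Category C

restrict : {C : Category o a e} {D : Category o′ a′ e′}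
           {P : Pred (Category.Obj C) p} {Q : Pred (Category.Obj D) p}
           (F : Functor C D) → (∀ {A} → P A → Q (Functor.F₀ F A)) →
           Functor (FullSubcategory C P) (FullSubcategory D Q)
restrict F pres = record
  { F₀           = λ A → F₀ (proj₁ A) , pres (proj₂ A)
  ; F₁           = F₁
  ; identity     = identity
  ; homomorphism = homomorphism
  ; F-resp-≈     = F-resp-≈
  } where open Functor F

------------------------------------------------------------------------
-- Rational arithmetic

open +-*-Solver

by≤ : ∀ {x y u v} → x ℚ.≤ y → v ℚ.- u ≡ y ℚ.- x → u ℚ.≤ v
by≤ {x} {y} {u} {v} x≤y eq = ℚₚ.≤-trans (ℚₚ.≤-reflexive u≡)
  (ℚₚ.≤-trans (ℚₚ.+-monoˡ-≤ (u ℚ.- x) x≤y) (ℚₚ.≤-reflexive v≡))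
  where
  u≡ : u ≡ x ℚ.+ (u ℚ.- x)
  u≡ = solve 2 (λ u x → u := x :+ (u :- x)) refl u x
  v≡ : y ℚ.+ (u ℚ.- x) ≡ v
  v≡ = trans (solve 3 (λ y u x → y :+ (u :- x) := u :+ (y :- x)) refl y u x)
       (trans (≡-cong (u ℚ.+_) (sym eq))
              (solve 2 (λ u v → u :+ (v :- u) := v) refl u v))

by< : ∀ {x y u v} → x ℚ.< y → v ℚ.- u ≡ y ℚ.- x → u ℚ.< v
by< {x} {y} {u} {v} x<y eq = ℚₚ.≤-<-trans (ℚₚ.≤-reflexive u≡)
  (ℚₚ.<-≤-trans (ℚₚ.+-monoˡ-< (u ℚ.- x) x<y) (ℚₚ.≤-reflexive v≡))
  where
  u≡ : u ≡ x ℚ.+ (u ℚ.- x)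
  u≡ = solve 2 (λ u x → u := x :+ (u :- x)) refl u x
  v≡ : y ℚ.+ (u ℚ.- x) ≡ v
  v≡ = trans (solve 3 (λ y u x → y :+ (u :- x) := u :+ (y :- x)) refl y u x)
       (trans (≡-cong (u ℚ.+_) (sym eq))
              (solve 2 (λ u v → u :+ (v :- u) := v) refl u v))

≤⊎> : ∀ x y → x ℚ.≤ y ⊎ y ℚ.< x
≤⊎> x y with x ℚₚ.≤? y
... | yes x≤y = inj₁ x≤y
... | no  x≰y = inj₂ (ℚₚ.≰⇒> x≰y)

≤-contra : ∀ {x y} {A : Set p} → x ℚ.≤ y → y ℚ.< x → A
≤-contra x≤y y<x = ⊥-elim (ℚₚ.<-irrefl refl (ℚₚ.≤-<-trans x≤y y<x))

0<1 : 0ℚ ℚ.< 1ℚ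
0<1 = ℚₚ.positive⁻¹ 1ℚ

------------------------------------------------------------------------
-- Real numbers: one-sided Dedekind cuts

-- x is represented by { q ∈ ℚ : q < x }, so that ≤ is inclusion and < is proper inclusion.
-- One-sided cuts are closed under bounded suprema constructively; under excluded middle
-- they are equivalent to two-sided (located) cuts.

record ℝ ℓ : Set (lsuc ℓ) where
  field
    cut       : Pred ℚ ℓ
    inhabited : ∃ cut
    proper    : ∃ λ q → ¬ cut q
    lowerSet  : ∀ {p q} → p ℚ.≤ q → cut q → cut p
    rounded   : ∀ {p} → cut p → ∃ λ q → p ℚ.< q × cut q

open ℝ public

infix 4 _≤_ _<_ _≈_
infixl 6 _+_ _⊓_ _⊔_

_≤_ _<_ _≈_ : Rel (ℝ ℓ) ℓ
x ≤ y = ∀ {q} → cut x q → cut y q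
x < y = ∃ λ q → cut y q × ¬ cut x q
x ≈ y = x ≤ y × y ≤ x

fromℚ : ℚ → ℝ ℓ
fromℚ {ℓ} r = record
  { cut       = λ q → Lift ℓ (q ℚ.< r)
  ; inhabited = r ℚ.- 1ℚ , lift (by< 0<1 (solve 1 (λ r → r :- (r :- con 1ℚ) := con 1ℚ :- con 0ℚ) refl r))
  ; proper    = r , λ r<r → ℚₚ.<-irrefl refl (lower r<r)
  ; lowerSet  = λ p≤q q<r → lift (ℚₚ.≤-<-trans p≤q (lower q<r))
  ; rounded   = λ p<r → let q , p<q , q<r = ℚₚ.<-dense (lower p<r) in q , p<q , lift q<r
  }

_+_ : ℝ ℓ → ℝ ℓ → ℝ ℓ
x + y = record
  { cut       = λ q → ∃₂ λ s t → cut x s × cut y t × q ≡ s ℚ.+ t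
  ; inhabited = _ , _ , _ , proj₂ (inhabited x) , proj₂ (inhabited y) , refl
  ; proper    = let s , s∉x = proper x ; t , t∉y = proper y in
                s ℚ.+ t , λ (s′ , t′ , s′∈x , t′∈y , eq) → bound s∉x t∉y s′∈x t′∈y eq
  ; lowerSet  = λ { {p} p≤q (s , t , s∈x , t∈y , refl) →
                  s , p ℚ.- s , s∈x
                , lowerSet y (by≤ p≤q (solve 3 (λ p s t → t :- (p :- s) := s :+ t :- p) refl p s t)) t∈y
                , solve 2 (λ p s → p := s :+ (p :- s)) refl p s }
  ; rounded   = λ { (s , t , s∈x , t∈y , refl) →
                  let s′ , s<s′ , s′∈x = rounded x s∈x in
                  s′ ℚ.+ t , ℚₚ.+-monoˡ-< t s<s′ , s′ , t , s′∈x , t∈y , refl }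
  }
  where
  bound : ∀ {s t s′ t′} {A : Set} → ¬ cut x s → ¬ cut y t → cut x s′ → cut y t′ →
          s ℚ.+ t ≡ s′ ℚ.+ t′ → A
  bound {s} {t} {s′} {t′} s∉x t∉y s′∈x t′∈y eq with ≤⊎> s s′ | ≤⊎> t t′
  ... | inj₁ s≤s′ | _         = ⊥-elim (s∉x (lowerSet x s≤s′ s′∈x))
  ... | inj₂ _    | inj₁ t≤t′ = ⊥-elim (t∉y (lowerSet y t≤t′ t′∈y))
  ... | inj₂ s′<s | inj₂ t′<t = ≤-contra (ℚₚ.≤-reflexive eq) (ℚₚ.+-mono-< s′<s t′<t)

_⊓_ : ℝ ℓ → ℝ ℓ → ℝ ℓ
x ⊓ y = record
  { cut       = λ q → cut x q × cut y q
  ; inhabited = let p , p∈x = inhabited x ; q , q∈y = inhabited y in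
                p ℚ.⊓ q , lowerSet x (ℚₚ.p⊓q≤p p q) p∈x , lowerSet y (ℚₚ.p⊓q≤q p q) q∈y
  ; proper    = let p , p∉x = proper x in p , λ p∈ → p∉x (proj₁ p∈)
  ; lowerSet  = λ p≤q (q∈x , q∈y) → lowerSet x p≤q q∈x , lowerSet y p≤q q∈y
  ; rounded   = λ (p∈x , p∈y) → round (rounded x p∈x) (rounded y p∈y)
  }
  where
  round : ∀ {p} → (∃ λ q → p ℚ.< q × cut x q) → (∃ λ q → p ℚ.< q × cut y q) →
          ∃ λ q → p ℚ.< q × cut x q × cut y q
  round (q , p<q , q∈x) (r , p<r , r∈y) with ≤⊎> q r
  ... | inj₁ q≤r = q , p<q , q∈x , lowerSet y q≤r r∈y
  ... | inj₂ r<q = r , p<r , lowerSet x (ℚₚ.<⇒≤ r<q) q∈x , r∈y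

_⊔_ : ℝ ℓ → ℝ ℓ → ℝ ℓ
x ⊔ y = record
  { cut       = λ q → cut x q ⊎ cut y q
  ; inhabited = let p , p∈x = inhabited x in p , inj₁ p∈x
  ; proper    = let p , p∉x = proper x ; q , q∉y = proper y in
                p ℚ.⊔ q , λ { (inj₁ m) → p∉x (lowerSet x (ℚₚ.p≤p⊔q p q) m)
                            ; (inj₂ m) → q∉y (lowerSet y (ℚₚ.p≤q⊔p p q) m) }
  ; lowerSet  = λ { p≤q (inj₁ m) → inj₁ (lowerSet x p≤q m)
                  ; p≤q (inj₂ m) → inj₂ (lowerSet y p≤q m) }
  ; rounded   = λ { (inj₁ m) → let q , p<q , q∈ = rounded x m in q , p<q , inj₁ q∈
                  ; (inj₂ m) → let q , p<q , q∈ = rounded y m in q , p<q , inj₂ q∈ }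
  }

------------------------------------------------------------------------
-- The unit interval

record [0,1] ℓ : Set (lsuc ℓ) where
  constructor ⟨_,_,_⟩
  field
    value : ℝ ℓ
    0≤    : fromℚ 0ℚ ≤ value
    ≤1    : value ≤ fromℚ 1ℚ

open [0,1] public

𝕀 : ∀ ℓ → Setoid (lsuc ℓ) ℓ
𝕀 ℓ = record
  { Carrier       = [0,1] ℓ
  ; _≈_           = λ x y → value x ≈ value y
  ; isEquivalence = record
    { refl  = (λ m → m) , (λ m → m)
    ; sym   = λ (f , g) → g , f
    ; trans = λ (f , g) (h , k) → (λ m → h (f m)) , (λ m → g (k m))
    }
  }

0ᴵ 1ᴵ : [0,1] ℓ
0ᴵ = ⟨ fromℚ 0ℚ , (λ m → m) , (λ m → lift (ℚₚ.<-trans (lower m) 0<1)) ⟩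
1ᴵ = ⟨ fromℚ 1ℚ , (λ m → lift (ℚₚ.<-trans (lower m) 0<1)) , (λ m → m) ⟩

infixl 6 _⊕ᴵ_ _∧ᴵ_
infixl 7 _⊙ᴵ_

0≤-split : (x y : [0,1] ℓ) → fromℚ 0ℚ ≤ value x + value y
0≤-split x y {q} (lift q<0) =
  ½ ℚ.* q , ½ ℚ.* q , 0≤ x (lift half<0) , 0≤ y (lift half<0)
  , solve 1 (λ q → q := con ½ :* q :+ con ½ :* q) refl q
  where
  half<0 : ½ ℚ.* q ℚ.< 0ℚ
  half<0 = ℚₚ.<-≤-trans (ℚₚ.*-monoʳ-<-pos ½ q<0) (ℚₚ.≤-reflexive refl)

-1ℚ : ℚ
-1ℚ = ℚ.- 1ℚ

_⊕ᴵ_ _⊙ᴵ_ _∧ᴵ_ : [0,1] ℓ → [0,1] ℓ → [0,1] ℓ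
x ⊕ᴵ y = ⟨ (value x + value y) ⊓ fromℚ 1ℚ , (λ m → 0≤-split x y m , 0≤ 1ᴵ m) , proj₂ ⟩
x ⊙ᴵ y = ⟨ (value x + value y + fromℚ (ℚ.- 1ℚ)) ⊔ fromℚ 0ℚ , inj₂ , ≤1′ ⟩
  where
  ≤1′ : (value x + value y + fromℚ (ℚ.- 1ℚ)) ⊔ fromℚ 0ℚ ≤ fromℚ 1ℚ
  ≤1′ (inj₂ m) = ≤1 0ᴵ m
  ≤1′ (inj₁ (_ , t , (u , v , u∈x , v∈y , refl) , lift t<-1 , refl)) = lift
    (by< (ℚₚ.+-mono-< (ℚₚ.+-mono-< (lower (≤1 x u∈x)) (lower (≤1 y v∈y))) t<-1)
         (solve 3 (λ u v t → con 1ℚ :- (u :+ v :+ t) :=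
                             con 1ℚ :+ con 1ℚ :+ con -1ℚ :- (u :+ v :+ t)) refl u v t))
x ∧ᴵ y = ⟨ value x ⊓ value y , (λ m → 0≤ x m , 0≤ y m) , (λ m → ≤1 x (proj₁ m)) ⟩

-- The supremum in [0,1]; the left summand only matters for the empty family, whose
-- supremum is 0.
⋁ᴵ : {J : Set ℓ} → (J → [0,1] ℓ) → [0,1] ℓ
⋁ᴵ {J = J} x = ⟨ sup , inj₁ , sup≤1 ⟩
  where
  sup : ℝ _
  sup≤1 : ∀ {q} → cut (fromℚ 0ℚ) q ⊎ (∃ λ (j : J) → cut (value (x j)) q) → cut (fromℚ 1ℚ) q
  sup≤1 (inj₁ m)       = ≤1 0ᴵ m
  sup≤1 (inj₂ (j , m)) = ≤1 (x j) m
  sup = record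
    { cut       = λ q → cut (fromℚ 0ℚ) q ⊎ ∃ λ (j : J) → cut (value (x j)) q
    ; inhabited = let q , q∈0 = inhabited (fromℚ 0ℚ) in q , inj₁ q∈0
    ; proper    = 1ℚ , λ m → ℚₚ.<-irrefl refl (lower (sup≤1 m))
    ; lowerSet  = λ { p≤q (inj₁ m) → inj₁ (lowerSet (fromℚ 0ℚ) p≤q m)
                    ; p≤q (inj₂ (j , m)) → inj₂ (j , lowerSet (value (x j)) p≤q m) }
    ; rounded   = λ { (inj₁ m) → let q , p<q , q∈ = rounded (fromℚ 0ℚ) m in q , p<q , inj₁ q∈
                    ; (inj₂ (j , m)) → let q , p<q , q∈ = rounded (value (x j)) m in
                                       q , p<q , inj₂ (j , q∈) }
    }

------------------------------------------------------------------------
-- [0,1]^X with the pointwise operations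

[0,1]^_ : Setoid ℓ ℓ → Set (lsuc ℓ)
[0,1]^_ {ℓ} X = Func X (𝕀 ℓ)

module _ {X : Setoid ℓ ℓ} where
  open Setoid X using (Carrier)

  at : [0,1]^ X → Carrier → ℝ ℓ
  at α x = value (Func.to α x)

  infix 4 _≈ᶠ_
  _≈ᶠ_ : Rel ([0,1]^ X) ℓ
  α ≈ᶠ β = ∀ x → at α x ≈ at β x

  𝟎 𝟏 : [0,1]^ X
  𝟎 = record { to = λ _ → 0ᴵ ; cong = λ _ → Setoid.refl (𝕀 ℓ) {0ᴵ} }
  𝟏 = record { to = λ _ → 1ᴵ ; cong = λ _ → Setoid.refl (𝕀 ℓ) {1ᴵ} }

  infixl 6 _⊕_ _∧_
  infixl 7 _⊙_
  _⊕_ _⊙_ _∧_ : [0,1]^ X → [0,1]^ X → [0,1]^ X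
  α ⊕ β = record
    { to   = λ x → Func.to α x ⊕ᴵ Func.to β x
    ; cong = λ x≈y → let f , f⁻ = Func.cong α x≈y ; g , g⁻ = Func.cong β x≈y in
        (λ ((s , t , m , n , eq) , k) → (s , t , f m , g n , eq) , k)
      , (λ ((s , t , m , n , eq) , k) → (s , t , f⁻ m , g⁻ n , eq) , k)
    }
  α ⊙ β = record
    { to   = λ x → Func.to α x ⊙ᴵ Func.to β x
    ; cong = λ x≈y → let f , f⁻ = Func.cong α x≈y ; g , g⁻ = Func.cong β x≈y in
        (λ { (inj₁ (_ , _ , (s , t , m , n , eq) , k)) → inj₁ (_ , _ , (s , t , f m , g n , eq) , k)
           ; (inj₂ m) → inj₂ m })
      , (λ { (inj₁ (_ , _ , (s , t , m , n , eq) , k)) → inj₁ (_ , _ , (s , t , f⁻ m , g⁻ n , eq) , k)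
           ; (inj₂ m) → inj₂ m })
    }
  α ∧ β = record
    { to   = λ x → Func.to α x ∧ᴵ Func.to β x
    ; cong = λ x≈y → let f , f⁻ = Func.cong α x≈y ; g , g⁻ = Func.cong β x≈y in
        (λ (m , n) → f m , g n) , (λ (m , n) → f⁻ m , g⁻ n)
    }

  ⋁ : {J : Set ℓ} → (J → [0,1]^ X) → [0,1]^ X
  ⋁ α = record
    { to   = λ x → ⋁ᴵ (λ j → Func.to (α j) x)
    ; cong = λ x≈y →
        (λ { (inj₁ m) → inj₁ m ; (inj₂ (j , m)) → inj₂ (j , proj₁ (Func.cong (α j) x≈y) m) })
      , (λ { (inj₁ m) → inj₁ m ; (inj₂ (j , m)) → inj₂ (j , proj₂ (Func.cong (α j) x≈y) m) })
    }

  ⨁ : List ([0,1]^ X) → [0,1]^ X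
  ⨁ = foldr _⊕_ 𝟎

  ⟦_>_⟧ : [0,1]^ X → ℝ ℓ → Pred Carrier ℓ
  ⟦ α > r ⟧ x = r < at α x

infixr 9 _∘ₛ_
_∘ₛ_ : ∀ {b₁ b₂ c₁ c₂ d₁ d₂} {X : Setoid b₁ b₂} {Y : Setoid c₁ c₂} {Z : Setoid d₁ d₂} →
       Func Y Z → Func X Y → Func X Z
g ∘ₛ f = Comp.function f g

------------------------------------------------------------------------
-- Topological spaces

-- Sets are setoids.  Here and below, "for every subset Γ of the topology" is rendered by
-- quantifying over families in the topology indexed by a small type J; under excluded middle
-- every subset is the range of such a family up to extensional equality, because cuts and
-- subsets can then be coded by Bool-valued functions.  The empty set is open as the empty union.
record TopSpace ℓ : Set (lsuc (lsuc ℓ)) where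
  field
    points : Setoid ℓ ℓ
  open Setoid points public using (Carrier) renaming (_≈_ to _≈ₚ_)
  field
    Open      : Pred (Pred Carrier ℓ) (lsuc ℓ)
    Open-resp : ∀ {U} → Open U → U Respects _≈ₚ_
    Open-≐    : ∀ {U V} → U ≐ V → Open U → Open V
    Open-⊤    : Open (λ _ → ⊤)
    Open-∩    : ∀ {U V} → Open U → Open V → Open (U ∩ V)
    Open-⋃    : {J : Set ℓ} {U : J → Pred Carrier ℓ} → (∀ j → Open (U j)) → Open (⋃ J U)

record TopMap (X Y : TopSpace ℓ) : Set (lsuc ℓ) where
  private
    module X = TopSpace X
    module Y = TopSpace Y
  field
    map        : Func X.points Y.points
    continuous : ∀ {U} → Y.Open U → X.Open (λ x → U (Func.to map x))

Top : ∀ ℓ → Category (lsuc (lsuc ℓ)) (lsuc ℓ) ℓ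
Top ℓ = record
  { Obj       = TopSpace ℓ
  ; _⇒_       = TopMap
  ; _≈_       = λ {X} {Y} f g → ∀ x → TopSpace._≈ₚ_ Y (Func.to (map f) x) (Func.to (map g) x)
  ; id        = λ {X} → record { map = Ident.function (points X) ; continuous = λ o → o }
  ; _∘_       = λ g f → record { map        = map g ∘ₛ map f
                               ; continuous = λ o → continuous f (continuous g o) }
  ; assoc     = λ {_} {_} {_} {D} _ → Setoid.refl (points D)
  ; identityˡ = λ {_} {B} _ → Setoid.refl (points B)
  ; identityʳ = λ {_} {B} _ → Setoid.refl (points B)
  ; equiv     = λ {_} {B} → record
    { refl  = λ _ → Setoid.refl (points B)
    ; sym   = λ f≈g x → Setoid.sym (points B) (f≈g x)
    ; trans = λ f≈g g≈h x → Setoid.trans (points B) (f≈g x) (g≈h x) }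
  ; ∘-resp-≈  = λ {_} {_} {C} {f} {h} {g} {i} f≈h g≈i x →
      Setoid.trans (points C) (Func.cong (map f) (g≈i x)) (f≈h (Func.to (map i) x))
  } where
    open TopSpace using (points)
    open TopMap

module _ (X : TopSpace ℓ) where
  open TopSpace X

  IsCompact : Set (lsuc ℓ)
  IsCompact = {J : Set ℓ} (U : J → Pred Carrier ℓ) → (∀ j → Open (U j)) →
              (∀ x → ⋃ J U x) → ∃ λ (js : List J) → ∀ x → Any (λ j → U j x) js

  IsHausdorff : Set (lsuc ℓ)
  IsHausdorff = ∀ x y → ¬ (x ≈ₚ y) →
                ∃₂ λ U V → Open U × Open V × U x × V y × (∀ z → ¬ (U z × V z))

  IsCompactHausdorff : Set (lsuc ℓ)
  IsCompactHausdorff = IsCompact × IsHausdorff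

KHaus : ∀ ℓ → Category (lsuc (lsuc ℓ)) (lsuc ℓ) ℓ
KHaus ℓ = FullSubcategory (Top ℓ) IsCompactHausdorff

------------------------------------------------------------------------
-- MV-topological spaces

record MVSpace ℓ : Set (lsuc (lsuc ℓ)) where
  field
    points : Setoid ℓ ℓ
  open Setoid points public using (Carrier) renaming (_≈_ to _≈ₚ_)
  field
    τ    : Pred ([0,1]^ points) (lsuc ℓ)
    τ-≈  : ∀ {α β} → α ≈ᶠ β → τ α → τ β
    τ-𝟎  : τ 𝟎
    τ-𝟏  : τ 𝟏
    τ-⋁  : {J : Set ℓ} {α : J → [0,1]^ points} → (∀ j → τ (α j)) → τ (⋁ α)
    τ-⊙  : ∀ {α β} → τ α → τ β → τ (α ⊙ β)
    τ-⊕  : ∀ {α β} → τ α → τ β → τ (α ⊕ β)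
    τ-∧  : ∀ {α β} → τ α → τ β → τ (α ∧ β)

record MVMap (X Y : MVSpace ℓ) : Set (lsuc ℓ) where
  private
    module X = MVSpace X
    module Y = MVSpace Y
  field
    map        : Func X.points Y.points
    continuous : ∀ {α} → Y.τ α → X.τ (α ∘ₛ map)

MVTop : ∀ ℓ → Category (lsuc (lsuc ℓ)) (lsuc ℓ) ℓ
MVTop ℓ = record
  { Obj       = MVSpace ℓ
  ; _⇒_       = MVMap
  ; _≈_       = λ {X} {Y} f g → ∀ x → MVSpace._≈ₚ_ Y (Func.to (map f) x) (Func.to (map g) x)
  ; id        = λ {X} → record { map        = Ident.function (points X)
                               ; continuous = λ t → MVSpace.τ-≈ X (λ _ → (λ m → m) , (λ m → m)) t }
  ; _∘_       = λ {A} g f → record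
    { map        = map g ∘ₛ map f
    ; continuous = λ t → MVSpace.τ-≈ A (λ _ → (λ m → m) , (λ m → m)) (continuous f (continuous g t)) }
  ; assoc     = λ {_} {_} {_} {D} _ → Setoid.refl (points D)
  ; identityˡ = λ {_} {B} _ → Setoid.refl (points B)
  ; identityʳ = λ {_} {B} _ → Setoid.refl (points B)
  ; equiv     = λ {_} {B} → record
    { refl  = λ _ → Setoid.refl (points B)
    ; sym   = λ f≈g x → Setoid.sym (points B) (f≈g x)
    ; trans = λ f≈g g≈h x → Setoid.trans (points B) (f≈g x) (g≈h x) }
  ; ∘-resp-≈  = λ {_} {_} {C} {f} {h} {g} {i} f≈h g≈i x →
      Setoid.trans (points C) (Func.cong (map f) (g≈i x)) (f≈h (Func.to (map i) x))
  } where
    open MVSpace using (points)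
    open MVMap

module _ (X : MVSpace ℓ) where
  open MVSpace X

  -- The finite family may be empty, with sum 𝟎; this only matters for empty X.
  IsCompactMV : Set (lsuc ℓ)
  IsCompactMV = {J : Set ℓ} (α : J → [0,1]^ points) → (∀ j → τ (α j)) →
                ⋁ α ≈ᶠ 𝟏 → ∃ λ (js : List J) → ⨁ (List.map α js) ≈ᶠ 𝟏

  IsHausdorffMV : Set (lsuc ℓ)
  IsHausdorffMV = ∀ x y → ¬ (x ≈ₚ y) →
                  ∃₂ λ α β → τ α × τ β × at α x ≈ fromℚ 1ℚ × at β y ≈ fromℚ 1ℚ × α ∧ β ≈ᶠ 𝟎

  IsCompactHausdorffMV : Set (lsuc ℓ)
  IsCompactHausdorffMV = IsCompactMV × IsHausdorffMV

HCMVTop : ∀ ℓ → Category (lsuc (lsuc ℓ)) (lsuc ℓ) ℓ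
HCMVTop ℓ = FullSubcategory (MVTop ℓ) IsCompactHausdorffMV

------------------------------------------------------------------------
-- The functor ω

module _ (X : TopSpace ℓ) where
  open TopSpace X

  LowerSemicontinuous : Pred ([0,1]^ points) (lsuc ℓ)
  LowerSemicontinuous α = ∀ r → Open ⟦ α > r ⟧

  RationalLSC : Pred ([0,1]^ points) (lsuc ℓ)
  RationalLSC α = ∀ q → Open (λ x → cut (at α x) q)

  lsc⇒ℚ : ∀ {α} → LowerSemicontinuous α → RationalLSC α
  lsc⇒ℚ {α} lsc q = Open-≐
    ( (λ {x} (p , p∈ , p≮q) → lowerSet (at α x) (ℚₚ.≮⇒≥ (λ p<q → p≮q (lift p<q))) p∈)
    , (λ q∈ → q , q∈ , λ q<q → ℚₚ.<-irrefl refl (lower q<q)) )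
    (lsc (fromℚ q))

  ℚ⇒lsc : ∀ {α} → RationalLSC α → LowerSemicontinuous α
  ℚ⇒lsc {α} lsc r = Open-≐
    ( (λ ((q , q∉r) , q∈) → q , q∈ , q∉r) , (λ (q , q∈ , q∉r) → (q , q∉r) , q∈) )
    (Open-⋃ {J = ∃ λ q → ¬ cut r q} (λ (q , _) → lsc q))

  Open-const : (A : Set ℓ) → Open (λ _ → A)
  Open-const A = Open-≐ ((λ (m , _) → m) , (λ m → m , tt)) (Open-⋃ {J = A} (λ _ → Open-⊤))

  Open-∪ : ∀ {U V} → Open U → Open V → Open (λ x → U x ⊎ V x)
  Open-∪ {U} {V} oU oV = Open-≐
    ( (λ { (lift true , m) → inj₁ m ; (lift false , m) → inj₂ m })
    , (λ { (inj₁ m) → lift true , m ; (inj₂ m) → lift false , m }) )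
    (Open-⋃ {J = Lift ℓ Bool} {U = pick} λ { (lift true) → oU ; (lift false) → oV })
    where
    pick : Lift ℓ Bool → Pred Carrier ℓ
    pick (lift true)  = U
    pick (lift false) = V

  Open-+ : (x y : Carrier → ℝ ℓ) → (∀ q → Open (λ z → cut (x z) q)) →
           (∀ q → Open (λ z → cut (y z) q)) → ∀ q → Open (λ z → cut (x z + y z) q)
  Open-+ x y ox oy q = Open-≐
    ( (λ ((s , t , lift eq) , m , n) → s , t , m , n , eq)
    , (λ (s , t , m , n , eq) → (s , t , lift eq) , m , n) )
    (Open-⋃ {J = ∃₂ λ s t → Lift ℓ (q ≡ s ℚ.+ t)} (λ (s , t , _) → Open-∩ (ox s) (oy t)))

  ω₀ : MVSpace ℓ
  ω₀ = record
    { points = points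
    ; τ      = LowerSemicontinuous
    ; τ-≈    = λ α≈β lsc r → Open-≐ ( (λ {x} (q , q∈ , q∉r) → q , proj₁ (α≈β x) q∈ , q∉r)
                                    , (λ {x} (q , q∈ , q∉r) → q , proj₂ (α≈β x) q∈ , q∉r) ) (lsc r)
    ; τ-𝟎    = λ r → Open-const _
    ; τ-𝟏    = λ r → Open-const _
    ; τ-⋁    = λ {J} {α} lsc → ℚ⇒lsc {⋁ α} λ q →
                 Open-∪ (Open-const _) (Open-⋃ (λ j → lsc⇒ℚ {α j} (lsc j) q))
    ; τ-⊙    = λ {α} {β} lα lβ → ℚ⇒lsc {α ⊙ β} λ q →
                 Open-∪ (Open-+ (λ x → at α x + at β x) (λ _ → fromℚ (ℚ.- 1ℚ))
                                (Open-+ (at α) (at β) (lsc⇒ℚ {α} lα) (lsc⇒ℚ {β} lβ))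
                                (λ _ → Open-const _) q)
                        (Open-const _)
    ; τ-⊕    = λ {α} {β} lα lβ → ℚ⇒lsc {α ⊕ β} λ q →
                 Open-∩ (Open-+ (at α) (at β) (lsc⇒ℚ {α} lα) (lsc⇒ℚ {β} lβ) q) (Open-const _)
    ; τ-∧    = λ {α} {β} lα lβ → ℚ⇒lsc {α ∧ β} λ q → Open-∩ (lsc⇒ℚ {α} lα q) (lsc⇒ℚ {β} lβ q)
    }

ω : Functor (Top ℓ) (MVTop ℓ)
ω = record
  { F₀           = ω₀
  ; F₁           = λ f → record { map = TopMap.map f ; continuous = λ lsc r → TopMap.continuous f (lsc r) }
  ; identity     = λ {A} _ → Setoid.refl (TopSpace.points A)
  ; homomorphism = λ {_} {_} {E} _ → Setoid.refl (TopSpace.points E)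
  ; F-resp-≈     = λ f≈g → f≈g
  }

------------------------------------------------------------------------
-- The functor ι

-- The least topology containing the sets S b.
data Generated {A : Set ℓ} {B : Set (lsuc ℓ)} (S : B → Pred A ℓ) :
               Pred (Pred A ℓ) (lsuc ℓ) where
  subbasic : ∀ b → Generated S (S b)
  whole    : Generated S (λ _ → ⊤)
  meet     : ∀ {U V} → Generated S U → Generated S V → Generated S (U ∩ V)
  union    : {J : Set ℓ} {U : J → Pred A ℓ} → (∀ j → Generated S (U j)) → Generated S (⋃ J U)
  ext      : ∀ {U V} → U ≐ V → Generated S U → Generated S V

module _ (X : MVSpace ℓ) where
  open MVSpace X

  record SubbaseIndex : Set (lsuc ℓ) where
    field
      μ   : [0,1]^ points
      μ∈τ : τ μ
      r   : ℝ ℓ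
      0≤r : fromℚ 0ℚ ≤ r
      r<1 : r < fromℚ 1ℚ

  Subbase : SubbaseIndex → Pred Carrier ℓ
  Subbase b = ⟦ SubbaseIndex.μ b > SubbaseIndex.r b ⟧

  Generated-resp : ∀ {U} → Generated Subbase U → U Respects _≈ₚ_
  Generated-resp (subbasic b) x≈y (q , q∈ , q∉r) =
    q , proj₁ (Func.cong (SubbaseIndex.μ b) x≈y) q∈ , q∉r
  Generated-resp whole x≈y _ = tt
  Generated-resp (meet g h) x≈y (m , n) = Generated-resp g x≈y m , Generated-resp h x≈y n
  Generated-resp (union g) x≈y (j , m) = j , Generated-resp (g j) x≈y m
  Generated-resp (ext (f , f⁻) g) x≈y m = f (Generated-resp g x≈y (f⁻ m))

  ι₀ : TopSpace ℓ
  ι₀ = record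
    { points    = points
    ; Open      = Generated Subbase
    ; Open-resp = Generated-resp
    ; Open-≐    = ext
    ; Open-⊤    = whole
    ; Open-∩    = meet
    ; Open-⋃    = union
    }

ιMV : Functor (MVTop ℓ) (Top ℓ)
ιMV = record
  { F₀           = ι₀
  ; F₁           = λ f → record { map = MVMap.map f ; continuous = pullback f }
  ; identity     = λ {A} _ → Setoid.refl (MVSpace.points A)
  ; homomorphism = λ {_} {_} {E} _ → Setoid.refl (MVSpace.points E)
  ; F-resp-≈     = λ f≈g → f≈g
  } where
  pullback : ∀ {X Y} (f : MVMap X Y) {U} → Generated (Subbase Y) U →
             Generated (Subbase X) (λ x → U (Func.to (MVMap.map f) x))
  pullback f (subbasic b)        = subbasic record
    { μ = μ ∘ₛ MVMap.map f ; μ∈τ = MVMap.continuous f μ∈τ ; r = r ; 0≤r = 0≤r ; r<1 = r<1 }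
    where open SubbaseIndex b
  pullback f whole               = whole
  pullback f (meet g h)          = meet (pullback f g) (pullback f h)
  pullback f (union g)           = union (λ j → pullback f (g j))
  pullback f (ext (to , from) g) = ext (to , from) (pullback f g)

------------------------------------------------------------------------
-- ι preserves compact Hausdorff spaces.  Key point: τ contains the characteristic function
-- of every open set of ι(τ).  For {μ > r}, iterating μ ↦ μ ⊕ μ and μ ↦ μ ⊙ μ along a
-- binary word w sends a cut to its preimage under the affine dyadic map `affine w`, and the
-- join over all words with affine w 0 ≥ q > r is the characteristic function.

affine₁ : Bool → ℚ → ℚ
affine₁ false p = ½ ℚ.* p
affine₁ true  p = ½ ℚ.* (p ℚ.+ 1ℚ)

affine : List Bool → ℚ → ℚ
affine []      p = p
affine (b ∷ w) p = affine₁ b (affine w p)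

½*-mono-≤ : ∀ {x y} → x ℚ.≤ y → ½ ℚ.* x ℚ.≤ ½ ℚ.* y
½*-mono-≤ = ℚₚ.*-monoˡ-≤-nonNeg ½

½*-mono-< : ∀ {x y} → x ℚ.< y → ½ ℚ.* x ℚ.< ½ ℚ.* y
½*-mono-< = ℚₚ.*-monoʳ-<-pos ½

affine₁-mono : ∀ b {x y} → x ℚ.≤ y → affine₁ b x ℚ.≤ affine₁ b y
affine₁-mono false x≤y = ½*-mono-≤ x≤y
affine₁-mono true  x≤y = ½*-mono-≤ (ℚₚ.+-monoˡ-≤ 1ℚ x≤y)

affine-mono : ∀ w {x y} → x ℚ.≤ y → affine w x ℚ.≤ affine w y
affine-mono []      x≤y = x≤y
affine-mono (b ∷ w) x≤y = affine₁-mono b (affine-mono w x≤y)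

affine₁-bounds : ∀ b {p} → 0ℚ ℚ.≤ p → p ℚ.< 1ℚ → 0ℚ ℚ.≤ affine₁ b p × affine₁ b p ℚ.< 1ℚ
affine₁-bounds false 0≤p p<1 = ½*-mono-≤ 0≤p , ℚₚ.<-trans (½*-mono-< p<1) (ℚ.*<* (ℤ.+<+ (ℕ.s≤s (ℕ.s≤s ℕ.z≤n))))
affine₁-bounds true  0≤p p<1 =
    ℚₚ.≤-trans (ℚ.*≤* (ℤ.+≤+ ℕ.z≤n)) (½*-mono-≤ (ℚₚ.+-monoˡ-≤ 1ℚ 0≤p))
  , ½*-mono-< (ℚₚ.+-monoˡ-< 1ℚ p<1)

affine-bounds : ∀ w {p} → 0ℚ ℚ.≤ p → p ℚ.< 1ℚ → 0ℚ ℚ.≤ affine w p × affine w p ℚ.< 1ℚ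
affine-bounds []      0≤p p<1 = 0≤p , p<1
affine-bounds (b ∷ w) 0≤p p<1 =
  let 0≤ , <1 = affine-bounds w 0≤p p<1 in affine₁-bounds b 0≤ <1

½^ : ℕ → ℚ
½^ zero    = 1ℚ
½^ (suc n) = ½ ℚ.* ½^ n

1/suc : ℕ → ℚ
1/suc n = mkℚ (+ 1) n (Coprimality.1-coprimeTo (suc n))

½^≤1/suc : ∀ n → ½^ n ℚ.≤ 1/suc n
½^≤1/suc zero    = ℚₚ.≤-refl
½^≤1/suc (suc n) = ℚₚ.≤-trans (½*-mono-≤ (½^≤1/suc n)) (ℚₚ.toℚᵘ-cancel-≤
  (ℚᵘₚ.≤-respˡ-≃ (ℚᵘₚ.≃-sym (ℚₚ.toℚᵘ-homo-* ½ (1/suc n))) (ℚᵘ.*≤* (ℤ.+≤+ arith))))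
  where
  arith : 1 ℕ.* suc (suc n) ℕ.≤ 1 ℕ.* (2 ℕ.* suc n)
  arith = ℕₚ.*-monoʳ-≤ 1 (ℕₚ.≤-trans (ℕ.s≤s (ℕₚ.m≤n+m (suc n) n))
            (ℕₚ.≤-reflexive (≡-cong
              (λ k → suc (n ℕ.+ k)) (sym (ℕₚ.+-identityʳ (suc n))))))

archimedean : ∀ δ → 0ℚ ℚ.< δ → ∃ λ n → ½^ n ℚ.≤ δ
archimedean δ@(mkℚ (+ suc m) d _) _ = d , ℚₚ.≤-trans (½^≤1/suc d)
  (ℚ.*≤* (ℤ.+≤+ (ℕₚ.*-monoˡ-≤ (suc d) (ℕ.s≤s {0} {m} ℕ.z≤n))))
archimedean (mkℚ (+ 0) d _) (ℚ.*<* (ℤ.+<+ ()))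
archimedean (mkℚ ℤ.-[1+ m ] d _) (ℚ.*<* ())

dyadic : ∀ n q → ℚ.- ½^ n ℚ.≤ q → q ℚ.≤ 1ℚ ℚ.- ½^ n →
         ∃ λ w → q ℚ.≤ affine w 0ℚ × affine w 1ℚ ℚ.≤ q ℚ.+ (½^ n ℚ.+ ½^ n)
dyadic zero q -1≤q q≤0 = [] , q≤0 , by≤ -1≤q
  (solve 1 (λ q → q :+ (con 1ℚ :+ con 1ℚ) :- con 1ℚ := q :- con -1ℚ) refl q)
dyadic (suc n) q lo hi with ≤⊎> (q ℚ.+ q) (1ℚ ℚ.- ½^ n)
... | inj₁ hi′ =
  let w , q≤ , ≤q = dyadic n (q ℚ.+ q)
                      (by≤ (ℚₚ.+-mono-≤ lo lo)
                        (solve 2 (λ q h → q :+ q :- (:- h) :=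
                           q :+ q :- ((:- (con ½ :* h)) :+ (:- (con ½ :* h)))) refl q (½^ n)))
                      hi′
  in false ∷ w
   , by≤ (½*-mono-≤ q≤) (solve 2 (λ q t → con ½ :* t :- q := con ½ :* t :- con ½ :* (q :+ q)) refl q (affine w 0ℚ))
   , by≤ (½*-mono-≤ ≤q) (solve 3 (λ q t h → q :+ (con ½ :* h :+ con ½ :* h) :- con ½ :* t :=
                                  con ½ :* (q :+ q :+ (h :+ h)) :- con ½ :* t) refl q (affine w 1ℚ) (½^ n))
... | inj₂ lo′ =
  let w , q≤ , ≤q = dyadic n (q ℚ.+ q ℚ.- 1ℚ)
                      (by≤ (ℚₚ.<⇒≤ lo′)
                        (solve 2 (λ q h → q :+ q :- con 1ℚ :- (:- h) := q :+ q :- (con 1ℚ :- h)) refl q (½^ n)))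
                      (by≤ (ℚₚ.+-mono-≤ hi hi)
                        (solve 2 (λ q h → con 1ℚ :- h :- (q :+ q :- con 1ℚ) :=
                           (con 1ℚ :- con ½ :* h) :+ (con 1ℚ :- con ½ :* h) :- (q :+ q)) refl q (½^ n)))
  in true ∷ w
   , by≤ (½*-mono-≤ q≤) (solve 2 (λ q t → con ½ :* (t :+ con 1ℚ) :- q :=
                                  con ½ :* t :- con ½ :* (q :+ q :- con 1ℚ)) refl q (affine w 0ℚ))
   , by≤ (½*-mono-≤ ≤q) (solve 3 (λ q t h → q :+ (con ½ :* h :+ con ½ :* h) :- con ½ :* (t :+ con 1ℚ) :=
                                  con ½ :* (q :+ q :- con 1ℚ :+ (h :+ h)) :- con ½ :* t) refl q (affine w 1ℚ) (½^ n))

approximate : ∀ {q s} → 0ℚ ℚ.≤ q → q ℚ.< s → s ℚ.< 1ℚ →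
              ∃ λ w → q ℚ.≤ affine w 0ℚ × affine w 1ℚ ℚ.≤ s
approximate {q} {s} 0≤q q<s s<1 = from-small (archimedean (½ ℚ.* (s ℚ.- q)) 0<δ)
  where
  0<δ : 0ℚ ℚ.< ½ ℚ.* (s ℚ.- q)
  0<δ = ½*-mono-< {0ℚ} {s ℚ.- q}
          (by< q<s (solve 2 (λ s q → s :- q :- con 0ℚ := s :- q) refl s q))

  -½^≤0 : ∀ n → ℚ.- ½^ n ℚ.≤ 0ℚ
  -½^≤0 n = ℚₚ.neg-antimono-≤ (0≤½^ n)
    where
    0≤½^ : ∀ n → 0ℚ ℚ.≤ ½^ n
    0≤½^ zero    = ℚₚ.<⇒≤ 0<1
    0≤½^ (suc n) = ½*-mono-≤ (0≤½^ n)

  below-1 : ∀ h → ℚ.- h ℚ.≤ 0ℚ → q ℚ.+ (h ℚ.+ h) ℚ.≤ s → q ℚ.≤ 1ℚ ℚ.- h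
  below-1 h -h≤0 ≤s = by≤ (ℚₚ.+-mono-≤ -h≤0 (ℚₚ.≤-trans ≤s (ℚₚ.<⇒≤ s<1)))
    (solve 2 (λ q h → con 1ℚ :- h :- q := con 0ℚ :+ con 1ℚ :- (:- h :+ (q :+ (h :+ h)))) refl q h)

  double : ∀ h → h ℚ.≤ ½ ℚ.* (s ℚ.- q) → q ℚ.+ (h ℚ.+ h) ℚ.≤ s
  double h small = by≤ (ℚₚ.+-mono-≤ small small)
    (solve 3 (λ q s h → s :- (q :+ (h :+ h)) :=
       con ½ :* (s :- q) :+ con ½ :* (s :- q) :- (h :+ h)) refl q s h)

  Target : ℚ → Set
  Target b = ∃ λ w → q ℚ.≤ affine w 0ℚ × affine w 1ℚ ℚ.≤ b

  relax : ∀ {b} → b ℚ.≤ s → Target b → Target s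
  relax b≤s (w , q≤ , ≤b) = w , q≤ , ℚₚ.≤-trans ≤b b≤s

  from-small : (∃ λ n → ½^ n ℚ.≤ ½ ℚ.* (s ℚ.- q)) → Target s
  from-small (n , small) = relax {q ℚ.+ (½^ n ℚ.+ ½^ n)} bound
    (dyadic n q (ℚₚ.≤-trans (-½^≤0 n) 0≤q) (below-1 (½^ n) (-½^≤0 n) bound))
    where
    bound : q ℚ.+ (½^ n ℚ.+ ½^ n) ℚ.≤ s
    bound = double (½^ n) small

module _ (X : MVSpace ℓ) where
  open MVSpace X

  iterate : List Bool → [0,1]^ points → [0,1]^ points
  iterate []          μ = μ
  iterate (false ∷ w) μ = iterate w (μ ⊕ μ)
  iterate (true  ∷ w) μ = iterate w (μ ⊙ μ)

  iterate-τ : ∀ w {μ} → τ μ → τ (iterate w μ)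
  iterate-τ []          t = t
  iterate-τ (false ∷ w) t = iterate-τ w (τ-⊕ t t)
  iterate-τ (true  ∷ w) t = iterate-τ w (τ-⊙ t t)

  halve : (x : ℝ ℓ) → ∀ {p s t} → cut x s → cut x t → p ℚ.≤ s ℚ.+ t → cut x (½ ℚ.* p)
  halve x {p} {s} {t} s∈x t∈x p≤ with ≤⊎> (½ ℚ.* p) s | ≤⊎> (½ ℚ.* p) t
  ... | inj₁ ≤s | _       = lowerSet x ≤s s∈x
  ... | inj₂ _  | inj₁ ≤t = lowerSet x ≤t t∈x
  ... | inj₂ s< | inj₂ t< = ≤-contra p≤
    (by< (ℚₚ.+-mono-< s< t<)
      (solve 3 (λ p s t → p :- (s :+ t) := con ½ :* p :+ con ½ :* p :- (s :+ t)) refl p s t))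

  iterate⇒ : ∀ w μ x {p} → 0ℚ ℚ.≤ p → p ℚ.< 1ℚ →
             cut (at (iterate w μ) x) p → cut (at μ x) (affine w p)
  iterate⇒ []          μ x 0≤p p<1 m = m
  iterate⇒ (false ∷ w) μ x 0≤p p<1 m with iterate⇒ w (μ ⊕ μ) x 0≤p p<1 m
  ... | (s , t , s∈ , t∈ , eq) , _ = halve (at μ x) s∈ t∈ (ℚₚ.≤-reflexive eq)
  iterate⇒ (true  ∷ w) μ x {p} 0≤p p<1 m with affine w p | affine-bounds w 0≤p p<1 | iterate⇒ w (μ ⊙ μ) x 0≤p p<1 m
  ... | _ | 0≤a , _ | inj₂ (lift a<0) = ≤-contra 0≤a a<0
  ... | _ | _ | inj₁ (_ , v , (s , t , s∈ , t∈ , refl) , lift v<-1 , refl) =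
    halve (at μ x) s∈ t∈ (by≤ (ℚₚ.<⇒≤ v<-1)
      (solve 3 (λ s t v → s :+ t :- (s :+ t :+ v :+ con 1ℚ) := con -1ℚ :- v) refl s t v))

  iterate⇐ : ∀ w μ x {p} → 0ℚ ℚ.≤ p → p ℚ.< 1ℚ →
             cut (at μ x) (affine w p) → cut (at (iterate w μ) x) p
  iterate⇐ []          μ x 0≤p p<1 m = m
  iterate⇐ (false ∷ w) μ x {p} 0≤p p<1 m = iterate⇐ w (μ ⊕ μ) x 0≤p p<1
    ( (_ , _ , m , m , solve 1 (λ a → a := con ½ :* a :+ con ½ :* a) refl (affine w p))
    , lift (proj₂ (affine-bounds w 0≤p p<1)))
  iterate⇐ (true  ∷ w) μ x {p} 0≤p p<1 m =
    let a = affine w p ; s , a<s , s∈ = rounded (at μ x) m in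
    iterate⇐ w (μ ⊙ μ) x 0≤p p<1 (inj₁
      ( s ℚ.+ s , a ℚ.- (s ℚ.+ s) , (s , s , s∈ , s∈ , refl)
      , lift (by< (ℚₚ.+-mono-< a<s a<s)
          (solve 2 (λ a s → con -1ℚ :- (a :- (s :+ s)) :=
             s :+ s :- (con ½ :* (a :+ con 1ℚ) :+ con ½ :* (a :+ con 1ℚ))) refl a s))
      , solve 2 (λ a s → a := s :+ s :+ (a :- (s :+ s))) refl a s))

  χ : (U : Pred Carrier ℓ) → U Respects _≈ₚ_ → [0,1]^ points
  χ U resp = record
    { to   = λ x → ⋁ᴵ {J = U x} (λ _ → 1ᴵ)
    ; cong = λ x≈y → (λ { (inj₁ m) → inj₁ m ; (inj₂ (u , m)) → inj₂ (resp x≈y u , m) })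
                   , (λ { (inj₁ m) → inj₁ m
                        ; (inj₂ (u , m)) → inj₂ (resp (Setoid.sym points x≈y) u , m) })
    }

  open TopSpace (ι₀ X) using (Open; Open-resp)

  χ-τ : ∀ {U} → Open U → (resp : U Respects _≈ₚ_) → τ (χ U resp)
  χ-τ (subbasic b) resp = τ-≈ (λ x → ⇒χ x , χ⇒ x)
    (τ-⋁ {J = J} {α = λ (_ , w , _) → iterate w μ} (λ (_ , w , _) → iterate-τ w μ∈τ))
    where
    open SubbaseIndex b
    J : Set _
    J = Σ[ q ∈ (∃ λ q → ¬ cut r q) ] Σ[ w ∈ List Bool ] proj₁ q ℚ.≤ affine w 0ℚ
    ⇒χ : ∀ x → at (⋁ {J = J} (λ (_ , w , _) → iterate w μ)) x ≤ at (χ (Subbase X b) resp) x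
    ⇒χ x (inj₁ m) = inj₁ m
    ⇒χ x {p} (inj₂ (((q , q∉r) , w , q≤) , m)) with ≤⊎> 0ℚ p
    ... | inj₂ p<0 = inj₁ (lift p<0)
    ... | inj₁ 0≤p = inj₂
      ( (q , lowerSet (at μ x) q≤ (iterate⇒ w μ x ℚₚ.≤-refl 0<1 (lowerSet (at (iterate w μ) x) 0≤p m)) , q∉r)
      , ≤1 (Func.to (iterate w μ) x) m )
    χ⇒ : ∀ x → at (χ (Subbase X b) resp) x ≤ at (⋁ {J = J} (λ (_ , w , _) → iterate w μ)) x
    χ⇒ x (inj₁ m) = inj₁ m
    χ⇒ x {p} (inj₂ ((q , q∈ , q∉r) , lift p<1)) with ≤⊎> 0ℚ p | ≤⊎> 0ℚ q
    ... | inj₂ p<0 | _        = inj₁ (lift p<0)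
    ... | inj₁ _   | inj₂ q<0 = ⊥-elim (q∉r (0≤r (lift q<0)))
    ... | inj₁ 0≤p | inj₁ 0≤q =
      let s , q<s , s∈ = rounded (at μ x) q∈
          w , q≤ , ≤s  = approximate 0≤q q<s (lower (≤1 (Func.to μ x) s∈))
      in inj₂ (((q , q∉r) , w , q≤)
         , iterate⇐ w μ x 0≤p p<1
             (lowerSet (at μ x) (ℚₚ.≤-trans (affine-mono w (ℚₚ.<⇒≤ p<1)) ≤s) s∈))
  χ-τ whole resp = τ-≈ (λ x → (λ m → inj₂ (tt , m))
                            , (λ { (inj₁ m) → 0≤ 1ᴵ m ; (inj₂ (_ , m)) → m })) τ-𝟏
  χ-τ (meet {U} {V} g h) resp =
    τ-≈ (λ x → (λ { (inj₁ m , _) → inj₁ m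
                  ; (inj₂ _ , inj₁ m) → inj₁ m
                  ; (inj₂ (u , m) , inj₂ (v , _)) → inj₂ ((u , v) , m) })
             , (λ { (inj₁ m) → inj₁ m , inj₁ m
                  ; (inj₂ ((u , v) , m)) → inj₂ (u , m) , inj₂ (v , m) }))
        (τ-∧ (χ-τ g (Open-resp g)) (χ-τ h (Open-resp h)))
  χ-τ (union g) resp =
    τ-≈ (λ x → (λ { (inj₁ m) → inj₁ m
                  ; (inj₂ (j , inj₁ m)) → inj₁ m
                  ; (inj₂ (j , inj₂ (u , m))) → inj₂ ((j , u) , m) })
             , (λ { (inj₁ m) → inj₁ m
                  ; (inj₂ ((j , u) , m)) → inj₂ (j , inj₂ (u , m)) }))
        (τ-⋁ (λ j → χ-τ (g j) (Open-resp (g j))))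
  χ-τ (ext (to , from) g) resp =
    τ-≈ (λ x → (λ { (inj₁ m) → inj₁ m ; (inj₂ (u , m)) → inj₂ (to u , m) })
             , (λ { (inj₁ m) → inj₁ m ; (inj₂ (u , m)) → inj₂ (from u , m) }))
        (χ-τ g (Open-resp g))

  ⨁χ⇒Any : {J : Set ℓ} (U : J → Pred Carrier ℓ) (resp : ∀ j → U j Respects _≈ₚ_) →
           ∀ js x {p} → 0ℚ ℚ.≤ p → cut (at (⨁ (List.map (λ j → χ (U j) (resp j)) js)) x) p →
           Any (λ j → U j x) js
  ⨁χ⇒Any U resp []       x 0≤p (lift p<0) = ≤-contra 0≤p p<0
  ⨁χ⇒Any U resp (j ∷ js) x 0≤p ((s , t , inj₂ (u , _) , _ , refl) , _) = here u
  ⨁χ⇒Any U resp (j ∷ js) x 0≤p ((s , t , inj₁ (lift s<0) , t∈ , refl) , _) =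
    there (⨁χ⇒Any U resp js x 0≤t t∈)
    where
    0≤t : 0ℚ ℚ.≤ t
    0≤t = by≤ (ℚₚ.+-mono-≤ 0≤p (ℚₚ.<⇒≤ s<0))
            (solve 2 (λ s t → t :- con 0ℚ := s :+ t :+ con 0ℚ :- (con 0ℚ :+ s)) refl s t)

  ι-compact : IsCompactMV X → IsCompact (ι₀ X)
  ι-compact compact U open-U cover =
    let js , eq = compact (λ j → χ (U j) (Open-resp (open-U j)))
                          (λ j → χ-τ (open-U j) (Open-resp (open-U j)))
                          (λ x → ≤1 (Func.to (⋁ (λ j → χ (U j) (Open-resp (open-U j)))) x)
                               , (λ m → let j , u = cover x in inj₂ (j , inj₂ (u , m))))
    in js , λ x → ⨁χ⇒Any U (λ j → Open-resp (open-U j)) js x ℚₚ.≤-refl (proj₂ (eq x) (lift 0<1))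

  ι-hausdorff : IsHausdorffMV X → IsHausdorff (ι₀ X)
  ι-hausdorff hausdorff x y x≉y =
    let α , β , α∈τ , β∈τ , αx≈1 , βy≈1 , α∧β≈𝟎 = hausdorff x y x≉y in
      ⟦ α > fromℚ 0ℚ ⟧ , ⟦ β > fromℚ 0ℚ ⟧ , subbasic (positive α∈τ) , subbasic (positive β∈τ)
    , (0ℚ , proj₂ αx≈1 (lift 0<1) , 0∉0) , (0ℚ , proj₂ βy≈1 (lift 0<1) , 0∉0)
    , λ z ((p , p∈ , p∉0) , (q , q∈ , q∉0)) → 0∉0 (proj₁ (α∧β≈𝟎 z)
        (lowerSet (at α z) (≮0 p∉0) p∈ , lowerSet (at β z) (≮0 q∉0) q∈))
    where
    0∉0 : ¬ cut (fromℚ {ℓ} 0ℚ) 0ℚ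
    0∉0 m = ℚₚ.<-irrefl refl (lower m)
    ≮0 : ∀ {q} → ¬ cut (fromℚ {ℓ} 0ℚ) q → 0ℚ ℚ.≤ q
    ≮0 q∉0 = ℚₚ.≮⇒≥ (λ q<0 → q∉0 (lift q<0))
    positive : ∀ {α} → τ α → SubbaseIndex X
    positive {α} α∈τ = record
      { μ = α ; μ∈τ = α∈τ ; r = fromℚ 0ℚ ; 0≤r = λ m → m ; r<1 = 0ℚ , lift 0<1 , 0∉0 }

ι : Functor (HCMVTop ℓ) (KHaus ℓ)
ι = restrict ιMV λ {X} (compact , hausdorff) → ι-compact X compact , ι-hausdorff X hausdorff

{-# OPTIONS --safe #-}

-- The functor ω is left adjoint to ι with both adjuncts the identity on points, ιω is the
-- identity, and ω preserves compact Hausdorff spaces: if the join of the αⱼ is 𝟏, then the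
-- open sets {αⱼ > ½} cover, and each αⱼ ⊕ αⱼ equals 1 on its own set.  So a map from X to a
-- compact Hausdorff K extends along X → ιβ̂ωX, by extending ωX → ωK along ωX → β̂ωX and
-- applying ι.  Extensions are unique although ωι is not the identity (constant functions
-- need not be open): for Y = β̂ωX, extending ωX → ωιY along ωX → Y shows that the identity
-- Y → ωιY is continuous, hence each continuous ιY → K is also a morphism Y → ωK.

module Submission where

open import Defs

open import Data.Empty using (⊥; ⊥-elim)
open import Data.List.Base using (List; []; _∷_; map)
open import Data.List.Relation.Unary.Any using (Any; here; there)
open import Data.Product using (∃; _,_; proj₁; proj₂)
open import Data.Rational.Base as ℚ using (0ℚ; 1ℚ; ½)
import Data.Rational.Properties as ℚₚ
open import Data.Rational.Solver using (module +-*-Solver)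
open import Data.Sum.Base using (inj₁; inj₂)
open import Data.Unit.Polymorphic.Base using (tt)
open import Function.Bundles using (Func)
open import Level using (Level; Lift; lift; lower) renaming (_⊔_ to _⊔ℓ_)
open import Relation.Binary.Bundles using (Setoid)
open import Relation.Binary.PropositionalEquality.Core using (refl)
import Relation.Binary.Reasoning.Setoid as SetoidReasoning
open import Relation.Binary.Structures using (IsEquivalence)
open import Relation.Nullary.Decidable.Core using (from-yes)

open +-*-Solver using (solve; _:=_; _:+_; _:-_; con)

private
  variable
    ℓ o a e o′ a′ e′ : Level

-- Universal arrows

homSetoid : (E : Category o a e) (A B : Category.Obj E) → Setoid a e
homSetoid E A B = record { isEquivalence = Category.equiv E {A} {B} }

module _ {C : Category o a e} {D : Category o′ a′ e′} where
  private
    module C where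
      open Category C public
      module _ {A B : Obj} where
        open IsEquivalence (equiv {A} {B}) public
    module D where
      open Category D public
      module _ {A B : Obj} where
        open IsEquivalence (equiv {A} {B}) public

  -- Uniqueness is phrased as cancellation along the unit, so that an instance can be built without
  -- a counit and without showing that `extend` respects equality.
  record Universal (L : Functor C D) (R : Functor D C) :
                   Set (o ⊔ℓ a ⊔ℓ e ⊔ℓ o′ ⊔ℓ a′ ⊔ℓ e′) where
    private
      module L = Functor L
      module R = Functor R
    field
      unit : NaturalTransformation idF (R ∘F L)
    open NaturalTransformation unit public
    field
      extend      : ∀ {A B} → A C.⇒ R.F₀ B → L.F₀ A D.⇒ B
      extend-unit : ∀ {A B} (f : A C.⇒ R.F₀ B) → R.F₁ (extend f) C.∘ η A C.≈ f
      unique      : ∀ {A B} (g h : L.F₀ A D.⇒ B) →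
                    R.F₁ g C.∘ η A C.≈ R.F₁ h C.∘ η A → g D.≈ h

  ⊣⇒Universal : {L : Functor C D} {R : Functor D C} → L ⊣ R → Universal L R
  ⊣⇒Universal {L} {R} L⊣R = record
    { unit        = unit
    ; extend      = extend
    ; extend-unit = extend-unit
    -- By `extend-η`, a map out of `L.F₀ A` is recovered from its restriction along the unit.
    ; unique      = λ g h eq → D.trans (D.sym (extend-η g))
                      (D.trans (D.∘-resp-≈ D.refl (L.F-resp-≈ eq)) (extend-η h))
    }
    where
    open _⊣_ L⊣R
    module L = Functor L
    module R = Functor R
    module η = NaturalTransformation unit
    module ε = NaturalTransformation counit

    extend : ∀ {A B} → A C.⇒ R.F₀ B → L.F₀ A D.⇒ B
    extend f = ε.η _ D.∘ L.F₁ f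

    extend-unit : ∀ {A B} (f : A C.⇒ R.F₀ B) → R.F₁ (extend f) C.∘ η.η A C.≈ f
    extend-unit {A} {B} f = begin
      R.F₁ (ε.η B D.∘ L.F₁ f) C.∘ η.η A           ≈⟨ C.∘-resp-≈ R.homomorphism C.refl ⟩
      (R.F₁ (ε.η B) C.∘ R.F₁ (L.F₁ f)) C.∘ η.η A  ≈⟨ C.assoc ⟩
      R.F₁ (ε.η B) C.∘ (R.F₁ (L.F₁ f) C.∘ η.η A)  ≈⟨ C.∘-resp-≈ C.refl (η.commute f) ⟨
      R.F₁ (ε.η B) C.∘ (η.η (R.F₀ B) C.∘ f)       ≈⟨ C.assoc ⟨
      (R.F₁ (ε.η B) C.∘ η.η (R.F₀ B)) C.∘ f       ≈⟨ C.∘-resp-≈ zag C.refl ⟩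
      C.id C.∘ f                                  ≈⟨ C.identityˡ ⟩
      f                                           ∎
      where open SetoidReasoning (homSetoid C A (R.F₀ B))

    extend-η : ∀ {A B} (g : L.F₀ A D.⇒ B) → extend (R.F₁ g C.∘ η.η A) D.≈ g
    extend-η {A} {B} g = begin
      ε.η B D.∘ L.F₁ (R.F₁ g C.∘ η.η A)           ≈⟨ D.∘-resp-≈ D.refl L.homomorphism ⟩
      ε.η B D.∘ (L.F₁ (R.F₁ g) D.∘ L.F₁ (η.η A))  ≈⟨ D.assoc ⟨
      (ε.η B D.∘ L.F₁ (R.F₁ g)) D.∘ L.F₁ (η.η A)  ≈⟨ D.∘-resp-≈ (ε.commute g) D.refl ⟩
      (g D.∘ ε.η (L.F₀ A)) D.∘ L.F₁ (η.η A)       ≈⟨ D.assoc ⟩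
      g D.∘ (ε.η (L.F₀ A) D.∘ L.F₁ (η.η A))       ≈⟨ D.∘-resp-≈ D.refl zig ⟩
      g D.∘ D.id                                  ≈⟨ D.identityʳ ⟩
      g                                           ∎
      where open SetoidReasoning (homSetoid D (L.F₀ A) B)

  module _ {L M : Functor C D} {R : Functor D C} (u : Universal L R) (v : Universal M R) where
    private
      module L = Functor L
      module M = Functor M
      module R = Functor R
      module u = Universal u
      module v = Universal v

    comparison : ∀ A → L.F₀ A D.⇒ M.F₀ A
    comparison A = u.extend (v.η A)

    -- Both sides of the square start at `L.F₀ A`, so it suffices to compare them after the unit,
    -- where both become `v.η B C.∘ f`.
    comparison-natural : NaturalTransformation L M
    comparison-natural = record
      { η       = comparison
      ; commute = λ {A} {B} f →
          let open SetoidReasoning (homSetoid C A (R.F₀ (M.F₀ B))) in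
          u.unique _ _ (begin
            R.F₁ (comparison B D.∘ L.F₁ f) C.∘ u.η A             ≈⟨ C.∘-resp-≈ R.homomorphism C.refl ⟩
            (R.F₁ (comparison B) C.∘ R.F₁ (L.F₁ f)) C.∘ u.η A    ≈⟨ C.assoc ⟩
            R.F₁ (comparison B) C.∘ (R.F₁ (L.F₁ f) C.∘ u.η A)    ≈⟨ C.∘-resp-≈ C.refl (u.commute f) ⟨
            R.F₁ (comparison B) C.∘ (u.η B C.∘ f)                ≈⟨ C.assoc ⟨
            (R.F₁ (comparison B) C.∘ u.η B) C.∘ f                ≈⟨ C.∘-resp-≈ (u.extend-unit (v.η B)) C.refl ⟩
            v.η B C.∘ f                                          ≈⟨ v.commute f ⟩
            R.F₁ (M.F₁ f) C.∘ v.η A                              ≈⟨ C.∘-resp-≈ C.refl (u.extend-unit (v.η A)) ⟨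
            R.F₁ (M.F₁ f) C.∘ (R.F₁ (comparison A) C.∘ u.η A)    ≈⟨ C.assoc ⟨
            (R.F₁ (M.F₁ f) C.∘ R.F₁ (comparison A)) C.∘ u.η A    ≈⟨ C.∘-resp-≈ R.homomorphism C.refl ⟨
            R.F₁ (M.F₁ f D.∘ comparison A) C.∘ u.η A             ∎)
      }

  -- The composite carries the unit of `u` to that of `v` and back, so it agrees with the identity
  -- after the unit.
  comparison-inverse : {L M : Functor C D} {R : Functor D C}
                       (u : Universal L R) (v : Universal M R) →
                       ∀ A → comparison v u A D.∘ comparison u v A D.≈ D.id
  comparison-inverse {L} {M} {R} u v A = u.unique _ _ (begin
    R.F₁ (comparison v u A D.∘ comparison u v A) C.∘ u.η A            ≈⟨ C.∘-resp-≈ R.homomorphism C.refl ⟩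
    (R.F₁ (comparison v u A) C.∘ R.F₁ (comparison u v A)) C.∘ u.η A   ≈⟨ C.assoc ⟩
    R.F₁ (comparison v u A) C.∘ (R.F₁ (comparison u v A) C.∘ u.η A)   ≈⟨ C.∘-resp-≈ C.refl (u.extend-unit (v.η A)) ⟩
    R.F₁ (comparison v u A) C.∘ v.η A                                 ≈⟨ v.extend-unit (u.η A) ⟩
    u.η A                                                             ≈⟨ C.identityˡ ⟨
    C.id C.∘ u.η A                                                    ≈⟨ C.∘-resp-≈ R.identity C.refl ⟨
    R.F₁ D.id C.∘ u.η A                                               ∎)
    where
    module R = Functor R
    module u = Universal u
    module v = Universal v
    open SetoidReasoning (homSetoid C A (R.F₀ (Functor.F₀ L A)))

  universal-unique : {L M : Functor C D} {R : Functor D C} →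
                     Universal L R → Universal M R → NaturalIsomorphism L M
  universal-unique u v = record
    { F⇒G  = comparison-natural u v
    ; F⇐G  = comparison-natural v u
    ; isoˡ = comparison-inverse u v
    ; isoʳ = comparison-inverse v u
    }

-- Truncated sums

≤-⊕ᴵʳ : (x y : [0,1] ℓ) → value y ≤ value (x ⊕ᴵ y)
≤-⊕ᴵʳ x y {q} m =
  -- If `x` is 0, its cut holds only negative numbers; passing to some `p` above `q` makes the other
  -- summand `q - p` negative.
  let p , q<p , p∈ = rounded (value y) m
  in ( q ℚ.- p , p
     , 0≤ x (lift (by< q<p (solve 2 (λ p q → con 0ℚ :- (q :- p) := p :- q) refl p q)))
     , p∈ , solve 2 (λ p q → q := q :- p :+ p) refl p q )
   , ≤1 y m

½<1 : ½ ℚ.< 1ℚ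
½<1 = from-yes (½ ℚₚ.<? 1ℚ)

-- Two copies of a number above ½ already reach 1; the tail `y` is carried along because `⨁` nests
-- to the right.
½∈⇒1≤x⊕x⊕y : (x y : [0,1] ℓ) → cut (value x) ½ → fromℚ 1ℚ ≤ value (x ⊕ᴵ (x ⊕ᴵ y))
½∈⇒1≤x⊕x⊕y x y ½∈x {q} (lift q<1) =
  let s , ½<s , s∈x = rounded (value x) ½∈x in
    -- Here `q` is split as ½ + s + (q - ½ - s); the last term is negative, as q < 1 and ½ < s,
    -- hence in the cut of `y`.
    ( ½ , q ℚ.- ½ , ½∈x
    , ( ( s , q ℚ.- ½ ℚ.- s , s∈x
        , 0≤ y (lift (by< (ℚₚ.+-mono-< q<1 ½<s)
            (solve 2 (λ q s → con 0ℚ :- (q :- con ½ :- s) := con 1ℚ :+ s :- (q :+ con ½)) refl q s)))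
        , solve 2 (λ q s → q :- con ½ := s :+ (q :- con ½ :- s)) refl q s )
      , lift (ℚₚ.<-trans (by< {x = q} {y = 1ℚ} q<1
          (solve 1 (λ q → con ½ :- (q :- con ½) := con 1ℚ :- q) refl q)) ½<1) )
    , solve 1 (λ q → q := con ½ :+ (q :- con ½)) refl q )
  , lift q<1

-- Finite subfamilies may repeat members, so each index of a subcover can be listed twice.
duplicate : {A : Set a} → List A → List A
duplicate []       = []
duplicate (x ∷ xs) = x ∷ x ∷ duplicate xs

module _ {X : Setoid ℓ ℓ} {J : Set ℓ} (α : J → [0,1]^ X) where

  ⨁-duplicate : ∀ js x → Any (λ j → cut (at (α j) x) ½) js →
                fromℚ 1ℚ ≤ at (⨁ (map α (duplicate js))) x
  ⨁-duplicate (j ∷ js) x (here ½∈αjx) =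
    ½∈⇒1≤x⊕x⊕y (Func.to (α j) x) (Func.to (⨁ (map α (duplicate js))) x) ½∈αjx
  ⨁-duplicate (j ∷ js) x (there any) m =
    ≤-⊕ᴵʳ y (y ⊕ᴵ z) (≤-⊕ᴵʳ y z (⨁-duplicate js x any m))
    where
    y = Func.to (α j) x
    z = Func.to (⨁ (map α (duplicate js))) x

-- The adjunction between ω and ι

module _ (Y : MVSpace ℓ) where
  open MVSpace Y
  open TopSpace (ι₀ Y) using (Open; Open-≐)

  -- This amounts to continuity of the identity from ωι(Y) to Y. Subbasic thresholds lie in [0,1); a
  -- threshold below 0 gives the whole space, and one from 1 on gives the empty set.
  τ⇒RationalLSC : ∀ {α} → τ α → RationalLSC (ι₀ Y) α
  τ⇒RationalLSC {α} α∈τ q with ≤⊎> 0ℚ q | ≤⊎> 1ℚ q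
  ... | inj₂ q<0 | _        = Open-≐ ((λ {y} _ → 0≤ (Func.to α y) (lift q<0)) , (λ _ → tt)) whole
  ... | inj₁ _   | inj₁ 1≤q = Open-≐
    ( (λ m → ⊥-elim (lower m))
    , (λ {y} m → ≤-contra 1≤q (lower (≤1 (Func.to α y) m))) )
    (Open-const (ι₀ Y) (Lift _ ⊥))
  ... | inj₁ 0≤q | inj₂ q<1 = Open-≐
    ( (λ {y} (p , p∈ , p≮q) → lowerSet (at α y) (ℚₚ.≮⇒≥ (λ p<q → p≮q (lift p<q))) p∈)
    , (λ q∈ → q , q∈ , λ q<q → ℚₚ.<-irrefl refl (lower q<q)) )
    (subbasic record
      { μ = α ; μ∈τ = α∈τ ; r = fromℚ q
      ; 0≤r = λ m → lift (ℚₚ.<-≤-trans (lower m) 0≤q)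
      ; r<1 = q , lift q<1 , λ q<q → ℚₚ.<-irrefl refl (lower q<q)
      })

module _ {X : TopSpace ℓ} {Y : MVSpace ℓ} where

  -- Preimages commute with the generation of the topology, and on a subbasic set openness is lower
  -- semicontinuity of `μ` composed with `f`.
  ω⇒ι : MVMap (ω₀ X) Y → TopMap X (ι₀ Y)
  ω⇒ι f = record { map = MVMap.map f ; continuous = pullback }
    where
    open TopSpace X
    pullback : ∀ {U} → Generated (Subbase Y) U → Open (λ x → U (Func.to (MVMap.map f) x))
    pullback (subbasic b)        = MVMap.continuous f (SubbaseIndex.μ∈τ b) (SubbaseIndex.r b)
    pullback whole               = Open-⊤
    pullback (meet g h)          = Open-∩ (pullback g) (pullback h)
    pullback (union g)           = Open-⋃ (λ j → pullback (g j))
    pullback (ext (to , from) g) = Open-≐ (to , from) (pullback g)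

  ι⇒ω : TopMap X (ι₀ Y) → MVMap (ω₀ X) Y
  ι⇒ω f = record
    { map        = TopMap.map f
    ; continuous = λ {α} α∈τ → ℚ⇒lsc X {α ∘ₛ TopMap.map f}
                     (λ q → TopMap.continuous f (τ⇒RationalLSC Y {α} α∈τ q))
    }

-- Characteristic functions, and compact Hausdorff spaces under ω

module _ (K : TopSpace ℓ) where
  open TopSpace K

  -- The cut condition at `q` unfolds to `q < 0`, or membership in `U` together with `q < 1`;
  -- constant propositions define open sets, so `q` needs no case split.
  χ-lsc : ∀ {U} (oU : Open U) → LowerSemicontinuous K (χ (ω₀ K) U (Open-resp oU))
  χ-lsc {U} oU = ℚ⇒lsc K {χ (ω₀ K) U (Open-resp oU)}
    (λ q → Open-∪ K (Open-const K _) (Open-∩ oU (Open-const K _)))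

  ιω⇒id : TopMap (ι₀ (ω₀ K)) K
  ιω⇒id = record
    { map        = TopMap.map (Category.id (Top ℓ) {K})
    -- An open set is where its characteristic function exceeds 0.
    ; continuous = λ oU → ext
        ( (λ { (inj₁ m) → ⊥-elim (ℚₚ.<-irrefl refl (lower m)) ; (inj₂ (u , _)) → u })
        , (λ u → inj₂ (u , lift 0<1)) )
        (τ⇒RationalLSC (ω₀ K) {χ (ω₀ K) _ (Open-resp oU)} (χ-lsc oU) 0ℚ)
    }

  ω-hausdorff : IsHausdorff K → IsHausdorffMV (ω₀ K)
  ω-hausdorff hausdorff x y x≉y =
    let U , V , oU , oV , x∈U , y∈V , disjoint = hausdorff x y x≉y in
      χ (ω₀ K) U (Open-resp oU) , χ (ω₀ K) V (Open-resp oV) , χ-lsc oU , χ-lsc oV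
    , ( ≤1 (Func.to (χ (ω₀ K) U (Open-resp oU)) x) , λ m → inj₂ (x∈U , m) )
    , ( ≤1 (Func.to (χ (ω₀ K) V (Open-resp oV)) y) , λ m → inj₂ (y∈V , m) )
    , λ z → (λ { (inj₁ m , _) → m
               ; (inj₂ _ , inj₁ m) → m
               ; (inj₂ (u , _) , inj₂ (v , _)) → ⊥-elim (disjoint z (u , v)) })
          , (λ m → inj₁ m , inj₁ m)

  ω-compact : IsCompact K → IsCompactMV (ω₀ K)
  ω-compact compact {J} α lsc ⋁α≈𝟏 =
    let js , ∈js = compact (λ j x → cut (at (α j) x) ½) (λ j → lsc⇒ℚ K {α j} (lsc j) ½) cover
    in duplicate js , λ x → ≤1 (Func.to (⨁ (map α (duplicate js))) x) , ⨁-duplicate α js x (∈js x)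
    where
    cover : ∀ x → ∃ λ j → cut (at (α j) x) ½
    cover x with proj₂ (⋁α≈𝟏 x) (lift ½<1)
    -- Joins carry an extra 0 for the empty family, and ½ is not below it.
    ... | inj₁ (lift ½<0) = ≤-contra (from-yes (0ℚ ℚₚ.≤? ½)) ½<0
    ... | inj₂ m          = m

  ω-compactHausdorff : IsCompactHausdorff K → IsCompactHausdorffMV (ω₀ K)
  ω-compactHausdorff (compact , hausdorff) = ω-compact compact , ω-hausdorff hausdorff

-- The universal property of ιβ̂ω

ιβ̂ω-universal : {β̂ : Functor (MVTop ℓ) (HCMVTop ℓ)} →
                Universal β̂ (Inclusion (MVTop ℓ) IsCompactHausdorffMV) →
                Universal (ι ∘F β̂ ∘F ω) (Inclusion (Top ℓ) IsCompactHausdorff)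
ιβ̂ω-universal {ℓ} {β̂} u = record
  -- Since ι and ω keep underlying maps and equality of maps is pointwise, equations between MV-maps
  -- serve unchanged in `Top`.
  { unit        = record { η       = λ X → ω⇒ι (u.η (ω₀ X))
                         ; commute = λ f → u.commute (Functor.F₁ ω f) }
  ; extend      = λ {X} {K} f → Category._∘_ (Top ℓ) (ιω⇒id (proj₁ K)) (Functor.F₁ ιMV (extendω X K f))
  ; extend-unit = λ {X} {K} f → u.extend-unit {B = ωK K} (Functor.F₁ ω f)
  ; unique      = λ {X} {K} → unique X K
  }
  where
  module u = Universal u
  open MVMap using () renaming (map to mapMV)
  open TopMap using () renaming (map to mapT)

  ωK : Category.Obj (KHaus ℓ) → Category.Obj (HCMVTop ℓ)
  ωK (K , hc) = ω₀ K , ω-compactHausdorff K hc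

  extendω : ∀ X K → TopMap X (proj₁ K) → MVMap (proj₁ (Functor.F₀ β̂ (ω₀ X))) (ω₀ (proj₁ K))
  extendω X K f = u.extend {B = ωK K} (Functor.F₁ ω f)

  -- `u.unique` compares MV-maps out of Y, whereas ω sends `g` and `h` to maps out of ωι(Y);
  -- precomposing with `refine` moves the domain to Y.
  unique : ∀ X K (g h : TopMap (ι₀ (proj₁ (Functor.F₀ β̂ (ω₀ X)))) (proj₁ K)) →
           (∀ x → TopSpace._≈ₚ_ (proj₁ K) (Func.to (mapT g) (Func.to (mapMV (u.η (ω₀ X))) x))
                                          (Func.to (mapT h) (Func.to (mapMV (u.η (ω₀ X))) x))) →
           ∀ y → TopSpace._≈ₚ_ (proj₁ K) (Func.to (mapT g) y) (Func.to (mapT h) y)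
  unique X K g h g≈h y =
    K.trans (K.sym (Func.cong (mapT g) (refine-id y)))
    (K.trans (u.unique {B = ωK K} (via g) (via h) agree y)
             (Func.cong (mapT h) (refine-id y)))
    where
    Y  = Functor.F₀ β̂ (ω₀ X)
    ιY = Functor.F₀ ι Y
    module K = Setoid (TopSpace.points (proj₁ K))

    -- Since ι and ω both preserve compact Hausdorff spaces, ωι(Y) is an admissible target for the
    -- universal property of Y.
    refine : MVMap (proj₁ Y) (ω₀ (ι₀ (proj₁ Y)))
    refine = extendω X ιY (ω⇒ι (u.η (ω₀ X)))

    refine-unit : ∀ x → MVSpace._≈ₚ_ (proj₁ Y)
                          (Func.to (mapMV refine) (Func.to (mapMV (u.η (ω₀ X))) x))
                          (Func.to (mapMV (u.η (ω₀ X))) x)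
    refine-unit = u.extend-unit {B = ωK ιY} (Functor.F₁ ω (ω⇒ι (u.η (ω₀ X))))

    -- Following `refine` by the continuous identity from ωι(Y) to Y gives an endomorphism of Y that
    -- fixes the unit, so uniqueness applies.
    refine-id : ∀ y → MVSpace._≈ₚ_ (proj₁ Y) (Func.to (mapMV refine) y) y
    refine-id = u.unique {B = Y}
      (Category._∘_ (MVTop ℓ) (ι⇒ω (Category.id (Top ℓ))) refine) (Category.id (MVTop ℓ)) refine-unit

    via : TopMap (ι₀ (proj₁ Y)) (proj₁ K) → MVMap (proj₁ Y) (ω₀ (proj₁ K))
    via k = Category._∘_ (MVTop ℓ) (Functor.F₁ ω k) refine

    agree : ∀ x → TopSpace._≈ₚ_ (proj₁ K) (Func.to (mapMV (via g)) (Func.to (mapMV (u.η (ω₀ X))) x))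
                                          (Func.to (mapMV (via h)) (Func.to (mapMV (u.η (ω₀ X))) x))
    agree x = K.trans (Func.cong (mapT g) (refine-unit x))
              (K.trans (g≈h x) (K.sym (Func.cong (mapT h) (refine-unit x))))

theorem7p5 : ∀ {ℓ} (β : Functor (Top ℓ) (KHaus ℓ)) (β̂ : Functor (MVTop ℓ) (HCMVTop ℓ)) →
    β ⊣ Inclusion (Top ℓ) IsCompactHausdorff →
    β̂ ⊣ Inclusion (MVTop ℓ) IsCompactHausdorffMV →
    NaturalIsomorphism β (ι ∘F β̂ ∘F ω)
theorem7p5 β β̂ β⊣ β̂⊣ = universal-unique (⊣⇒Universal β⊣) (ιβ̂ω-universal (⊣⇒Universal β̂⊣))
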